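{- There is no distributive law $\mathsf{P}_{\mathsf{f}}D\to D\mathsf{P}_{\mathsf{f}}$, where $\mathsf{P}_{\mathsf{f}}$ is the finite powerset monad and $D$ the coinductive delay monad.
   Context: The finite powerset monad $\mathsf{P}_{\mathsf{f}}$ is the free model monad of the theory of semilattices: a constant $\emptyset$ and a binary operation $\cup$ satisfying $\emptyset\cup x=x=x\cup\emptyset$, associativity, commutativity and idempotence ($x\cup x=x$); in type theory it is realised as a higher inductive type generated by singletons, $\cup$, $\emptyset$, paths for the equations, and set truncation. $D$ is the coinductive delay monad: $DX$ is the final coalgebra $DX\simeq X+DX$ with $\mathsf{now}:X\to DX$ and $\mathsf{step}:DX\to DX$ (in Clocked Cubical Type Theory, $DX=\forall\kappa.D^\kappa X$). A distributive law $\zeta:\mathsf{P}_{\mathsf{f}}D\to D\mathsf{P}_{\mathsf{f}}$ is a natural transformation satisfying $\zeta\circ\eta^{P}D=D\eta^{P}$, $\zeta\circ \mathsf{P}_{\mathsf{f}}\eta^D=\eta^D\mathsf{P}_{\mathsf{f}}$, $\zeta\circ\mu^{P}D=D\mu^{P}\circ\zeta\mathsf{P}_{\mathsf{f}}\circ\mathsf{P}_{\mathsf{f}}\zeta$, $\zeta\circ\mathsf{P}_{\mathsf{f}}\mu^D=\mu^D\mathsf{P}_{\mathsf{f}}\circ D\zeta\circ\zeta D$. -}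

module Defs where

open import Data.Nat using (ℕ; zero; suc)
open import Data.Maybe using (Maybe; just; nothing)
open import Data.List using (List; []; _∷_; map; concat; [_])
open import Data.List.Relation.Unary.All using (All)
open import Data.List.Relation.Unary.Any using (Any)
open import Data.Product using (Σ; _×_; _,_; proj₁; proj₂)
open import Data.Sum using (_⊎_; inj₁; inj₂)
open import Relation.Binary.PropositionalEquality using (_≡_; refl)

-- Finite powerset monad P_f, presented as lists modulo "same elements".
-- (Cubical HITs are unavailable; a function out of the HIT P_f X is
-- exactly a function on lists that respects the relation SameSet _≡_.)

Pf : Set → Set
Pf A = List A

SameSet : {A B : Set} → (A → B → Set) → List A → List B → Set
SameSet R xs ys =
  All (λ x → Any (λ y → R x y) ys) xs × All (λ y → Any (λ x → R x y) xs) ys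

ηP : {A : Set} → A → Pf A
ηP = [_]

μP : {A : Set} → Pf (Pf A) → Pf A
μP = concat

PfMap : {A B : Set} → (A → B) → Pf A → Pf B
PfMap = map

-- Delay monad D X, the final coalgebra of X ↦ X + D X.

Seq : Set → Set
Seq A = ℕ → Maybe A

Mono : {A : Set} → Seq A → Set
Mono s = ∀ n a → s n ≡ just a → s (suc n) ≡ just a

D : Set → Set
D A = Σ (Seq A) Mono

now : {A : Set} → A → D A
now a = (λ _ → just a) , (λ _ _ h → h)

stepS : {A : Set} → Seq A → Seq A
stepS s zero = nothing
stepS s (suc n) = s n

step : {A : Set} → D A → D A
step (s , m) = stepS s , mono
  where
  mono : Mono (stepS s)
  mono zero a ()
  mono (suc n) a h = m n a h

force : {A : Set} → D A → A ⊎ D A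
force (s , m) with s 0
... | just a = inj₁ a
... | nothing = inj₂ ((λ n → s (suc n)) , (λ n a h → m (suc n) a h))

mapM : {A B : Set} → (A → B) → Maybe A → Maybe B
mapM f nothing = nothing
mapM f (just a) = just (f a)

DMap : {A B : Set} → (A → B) → D A → D B
DMap f (s , m) = (λ n → mapM f (s n)) , mono
  where
  mono : Mono (λ n → mapM f (s n))
  mono n b h with s n in eq
  mono n b refl | just a rewrite m n a eq = refl

ηD : {A : Set} → A → D A
ηD = now

-- multiplication μ^D : D (D X) → D X  (now e ↦ e, step d ↦ step (μ^D d))
j0 : {A : Set} → Maybe (D A) → Maybe A
j0 nothing = nothing
j0 (just e) = proj₁ e 0

jS : {A : Set} → Maybe (D A) → ℕ → Maybe A → Maybe A
jS nothing n r = r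
jS (just e) n r = proj₁ e (suc n)

joinS : {A : Set} → Seq (D A) → Seq A
joinS s zero = j0 (s 0)
joinS s (suc n) = jS (s 0) n (joinS (λ k → s (suc k)) n)

joinMono : {A : Set} (s : Seq (D A)) → Mono s → Mono (joinS s)
joinMono s m zero a h with s 0
... | just e = proj₂ e 0 a h
joinMono s m (suc n) a h with s 0
... | just e = proj₂ e (suc n) a h
... | nothing = joinMono (λ k → s (suc k)) (λ k → m (suc k)) n a h

μD : {A : Set} → D (D A) → D A
μD (s , m) = joinS s , joinMono s m

-- Equality of computations relative to an equality R on values:
-- strong bisimilarity (in Clocked Cubical Type Theory this coincides with
-- path equality in D).
data MaybeRel {A B : Set} (R : A → B → Set) : Maybe A → Maybe B → Set where
  nothing : MaybeRel R nothing nothing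
  just    : ∀ {a b} → R a b → MaybeRel R (just a) (just b)

Bisim : {A B : Set} → (A → B → Set) → D A → D B → Set
Bisim R d e = ∀ n → MaybeRel R (proj₁ d n) (proj₁ e n)

_≈PD_ : {A : Set} → Pf (D A) → Pf (D A) → Set
_≈PD_ = SameSet (Bisim _≡_)

_≈DP_ : {A : Set} → D (Pf A) → D (Pf A) → Set
_≈DP_ = Bisim (SameSet _≡_)

record IsDistributiveLaw (ζ : {A : Set} → Pf (D A) → D (Pf A)) : Set₁ where
  field
    -- ζ is a well-defined function on the quotient P_f (D A)
    respects : {A : Set} {xs ys : Pf (D A)} → xs ≈PD ys → ζ xs ≈DP ζ ys
    natural : {A B : Set} (f : A → B) (xs : Pf (D A)) →
      ζ (PfMap (DMap f) xs) ≈DP DMap (PfMap f) (ζ xs)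
    unitP : {A : Set} (d : D A) → ζ (ηP d) ≈DP DMap ηP d
    unitD : {A : Set} (xs : Pf A) → ζ (PfMap ηD xs) ≈DP ηD xs
    multP : {A : Set} (xss : Pf (Pf (D A))) →
      ζ (μP xss) ≈DP DMap μP (ζ (PfMap ζ xss))
    multD : {A : Set} (xs : Pf (D (D A))) →
      ζ (PfMap μD xs) ≈DP μD (DMap ζ (ζ xs))

module Submission where

-- Let v = ζ {now true, step (now false)}. By naturality, ζ {now x, step (now y)} is v with
-- true, false renamed to x, y. The multiplication law of P_f at {∅, {step (now false)}}
-- shows that v has not terminated at stage 0 and that false is in its value at stage 1.
-- Now apply the multiplication law of D to {now (step (now true)), step (now (now false))},
-- whose elementwise join is {step (now true), step (now false)}; ζ of the latter contains
-- true at stage 1 (unit law, plus the symmetry true ↔ false). Hence ζ T must terminate at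
-- stage 0 with a value containing true, where T is the stage-1 value of
-- ζ {now (step (now true)), step (now (now false))}. But T is, as a set, a renaming of the
-- stage-1 value of v: either {now false, step (now true)}, whose image under ζ is a
-- renaming of v and so silent at stage 0, or {now false}, whose image is now {false}.

module Submission where

open import Defs
open import Relation.Nullary using (¬_)

open import Data.Bool using (Bool; true; false; not; if_then_else_)
open import Data.Bool.Properties using () renaming (_≟_ to _≟ᵇ_)
open import Data.Empty using (⊥; ⊥-elim)
open import Data.List using (List; []; _∷_; [_])
open import Data.List.Membership.Propositional using (_∈_)
open import Data.List.Membership.DecPropositional _≟ᵇ_ using (_∈?_)
open import Data.List.Membership.Propositional.Properties using (∈-map⁺; ∈-map⁻; ∈-concat⁻′)
open import Data.List.Relation.Binary.Pointwise using (Pointwise; []; _∷_)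
open import Data.List.Relation.Binary.Subset.Propositional using (_⊆_)
open import Data.List.Relation.Binary.Subset.Propositional.Properties using (map⁺)
open import Data.List.Relation.Unary.All as All using (All; []; _∷_)
open import Data.List.Relation.Unary.Any as Any using (Any; here; there)
open import Data.List.Relation.Unary.Any.Properties using (¬Any[])
open import Data.Maybe using (Maybe; just; nothing)
open import Data.Nat using (ℕ; zero; suc; _≤′_; ≤′-refl; ≤′-step)
open import Data.Nat.Properties using (z≤′n; s≤′s)
open import Data.Product using (Σ; ∃-syntax; _×_; _,_; proj₁; proj₂)
open import Data.Sum using (_⊎_; inj₁; inj₂)
open import Relation.Binary.Definitions using (Transitive)
open import Relation.Binary.PropositionalEquality using (_≡_; refl; sym; trans; subst)
open import Relation.Nullary using (yes; no)

private
  variable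
    A B : Set

SameSet-mono : {R S : A → B → Set} → (∀ {a b} → R a b → S a b) →
  ∀ {xs ys} → SameSet R xs ys → SameSet S xs ys
SameSet-mono f (xs⊆ys , ys⊆xs) = All.map (Any.map f) xs⊆ys , All.map (Any.map f) ys⊆xs

SameSet-trans : {R : A → A → Set} → Transitive R → Transitive (SameSet R)
SameSet-trans {R = R} trans (xs⊆ys , ys⊆xs) (ys⊆zs , zs⊆ys) =
  covers trans xs⊆ys ys⊆zs , covers (λ p q → trans q p) zs⊆ys ys⊆xs
  where
  covers : {S : A → A → Set} → (∀ {a b c} → S a b → S b c → S a c) → ∀ {xs ys zs} →
    All (λ x → Any (S x) ys) xs → All (λ y → Any (S y) zs) ys → All (λ x → Any (S x) zs) xs
  covers t [] _ = []
  covers t (x∼ys ∷ xs∼ys) ys∼zs =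
    let y∼zs , x∼y = All.lookupAny ys∼zs x∼ys
    in Any.map (t x∼y) y∼zs ∷ covers t xs∼ys ys∼zs

Pointwise⇒SameSet : {R : A → B → Set} → ∀ {xs ys} → Pointwise R xs ys → SameSet R xs ys
Pointwise⇒SameSet [] = [] , []
Pointwise⇒SameSet (r ∷ rs) =
  let xs⊆ys , ys⊆xs = Pointwise⇒SameSet rs
  in here r ∷ All.map there xs⊆ys , here r ∷ All.map there ys⊆xs

SameSet⇒⊆ : {xs ys : List A} → SameSet _≡_ xs ys → xs ⊆ ys
SameSet⇒⊆ (xs⊆ys , _) = All.lookup xs⊆ys

SameSet⇒⊇ : {xs ys : List A} → SameSet _≡_ xs ys → ys ⊆ xs
SameSet⇒⊇ (_ , ys⊆xs) y∈ys = Any.map sym (All.lookup ys⊆xs y∈ys)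

⊆⇒SameSet : {xs ys : List A} → xs ⊆ ys → ys ⊆ xs → SameSet _≡_ xs ys
⊆⇒SameSet xs⊆ys ys⊆xs = All.tabulate xs⊆ys , All.tabulate (λ y∈ys → Any.map sym (ys⊆xs y∈ys))

SameSet-map : (f : A → B) {xs ys : List A} →
  SameSet _≡_ xs ys → SameSet _≡_ (PfMap f xs) (PfMap f ys)
SameSet-map f xs≈ys = ⊆⇒SameSet (map⁺ f (SameSet⇒⊆ xs≈ys)) (map⁺ f (SameSet⇒⊇ xs≈ys))

SameSet-[] : {xs : List A} → SameSet _≡_ xs [] → xs ≡ []
SameSet-[] {xs = []} _ = refl
SameSet-[] {xs = _ ∷ _} ((() ∷ _) , _)

Bool-set-with-false : (S : List Bool) → false ∈ S →
  SameSet _≡_ S (false ∷ true ∷ []) ⊎ SameSet _≡_ S [ false ]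
Bool-set-with-false S false∈S with true ∈? S
... | yes true∈S = inj₁ (⊆⇒SameSet every-Bool λ { (here refl) → false∈S ; (there (here refl)) → true∈S })
  where
  every-Bool : S ⊆ false ∷ true ∷ []
  every-Bool {false} _ = here refl
  every-Bool {true}  _ = there (here refl)
... | no true∉S = inj₂ (⊆⇒SameSet only-false λ { (here refl) → false∈S })
  where
  only-false : S ⊆ [ false ]
  only-false {false} _ = here refl
  only-false {true}  true∈S = ⊥-elim (true∉S true∈S)

SameSet-swap : {R : A → B → Set} {x y : A} {x′ y′ : B} →
  R x y′ → R y x′ → SameSet R (x ∷ y ∷ []) (x′ ∷ y′ ∷ [])
SameSet-swap r s = (there (here r) ∷ here s ∷ []) , (there (here s) ∷ here r ∷ [])

MaybeRel-trans : {R : A → A → Set} → Transitive R →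
  {x y z : Maybe A} → MaybeRel R x y → MaybeRel R y z → MaybeRel R x z
MaybeRel-trans t nothing  nothing  = nothing
MaybeRel-trans t (just p) (just q) = just (t p q)

MaybeRel-nothingˡ : {R : A → B → Set} {x : Maybe A} {y : Maybe B} →
  MaybeRel R x y → x ≡ nothing → y ≡ nothing
MaybeRel-nothingˡ nothing refl = refl

MaybeRel-nothingʳ : {R : A → B → Set} {x : Maybe A} {y : Maybe B} →
  MaybeRel R x y → y ≡ nothing → x ≡ nothing
MaybeRel-nothingʳ nothing refl = refl

MaybeRel-justʳ : {R : A → B → Set} {x : Maybe A} {y : Maybe B} {b : B} →
  MaybeRel R x y → y ≡ just b → ∃[ a ] x ≡ just a × R a b
MaybeRel-justʳ (just r) refl = _ , refl , r

mapM-nothing : (f : A → B) {x : Maybe A} → x ≡ nothing → mapM f x ≡ nothing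
mapM-nothing f refl = refl

mapM-nothing⁻ : (f : A → B) {x : Maybe A} → mapM f x ≡ nothing → x ≡ nothing
mapM-nothing⁻ f {nothing} _ = refl

mapM-just : (f : A → B) {x : Maybe A} {a : A} → x ≡ just a → mapM f x ≡ just (f a)
mapM-just f refl = refl

-- Bisimilarity constrains only the stages proj₁ d n of a computation d, so facts about
-- computations are stated about these stage values, which Agda can then infer.
_∈ᴹ_ : A → Maybe (Pf A) → Set
a ∈ᴹ x = ∃[ S ] x ≡ just S × a ∈ S

∉ᴹ-nothing : {a : A} {x : Maybe (Pf A)} → x ≡ nothing → ¬ a ∈ᴹ x
∉ᴹ-nothing refl (_ , () , _)

∈ᴹ-resp : {a : A} {x y : Maybe (Pf A)} → MaybeRel (SameSet _≡_) x y → a ∈ᴹ x → a ∈ᴹ y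
∈ᴹ-resp (just S≈S′) (S , refl , a∈S) = _ , refl , SameSet⇒⊆ S≈S′ a∈S

∈ᴹ-resp⁻ : {a : A} {x y : Maybe (Pf A)} → MaybeRel (SameSet _≡_) x y → a ∈ᴹ y → a ∈ᴹ x
∈ᴹ-resp⁻ (just S≈S′) (S′ , refl , a∈S′) = _ , refl , SameSet⇒⊇ S≈S′ a∈S′

∈ᴹ-map⁺ : (f : A → B) {a : A} {x : Maybe (Pf A)} → a ∈ᴹ x → f a ∈ᴹ mapM (PfMap f) x
∈ᴹ-map⁺ f (S , refl , a∈S) = PfMap f S , refl , ∈-map⁺ f a∈S

∈ᴹ-map⁻ : (f : A → B) {b : B} {x : Maybe (Pf A)} → b ∈ᴹ mapM (PfMap f) x → ∃[ a ] a ∈ᴹ x × b ≡ f a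
∈ᴹ-map⁻ f {x = just S} (_ , refl , b∈fS) =
  let a , a∈S , b≡fa = ∈-map⁻ f b∈fS in a , (S , refl , a∈S) , b≡fa

∈ᴹ-concat⁻ : {a : A} {x : Maybe (Pf (Pf A))} → a ∈ᴹ mapM μP x → ∃[ S ] S ∈ᴹ x × a ∈ S
∈ᴹ-concat⁻ {x = just Ss} (_ , refl , a∈⋃Ss) =
  let S , a∈S , S∈Ss = ∈-concat⁻′ Ss a∈⋃Ss in S , (Ss , refl , S∈Ss) , a∈S

≡⇒Bisim : {d e : D A} → d ≡ e → Bisim _≡_ d e
≡⇒Bisim {d = d} refl n with proj₁ d n
... | nothing = nothing
... | just _  = just refl

≡⇒≈PD : {xs ys : Pf (D A)} → SameSet _≡_ xs ys → xs ≈PD ys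
≡⇒≈PD = SameSet-mono ≡⇒Bisim

stage-mono : (d : D A) {m n : ℕ} {a : A} → m ≤′ n → proj₁ d m ≡ just a → proj₁ d n ≡ just a
stage-mono d ≤′-refl         d↓ = d↓
stage-mono d (≤′-step m≤n) d↓ = proj₂ d _ _ (stage-mono d m≤n d↓)

≈now : (d : D A) {a : A} → proj₁ d 0 ≡ just a → Bisim _≡_ d (now a)
≈now d d↓ n rewrite stage-mono d {n = n} z≤′n d↓ = just refl

≈step-now : (d : D A) {a : A} → proj₁ d 0 ≡ nothing → proj₁ d 1 ≡ just a → Bisim _≡_ d (step (now a))
≈step-now d d↑ d↓ zero    rewrite d↑ = nothing
≈step-now d d↑ d↓ (suc n) rewrite stage-mono d {n = suc n} (s≤′s z≤′n) d↓ = just refl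

DMap-now : (f : A → B) (a : A) → Bisim _≡_ (now (f a)) (DMap f (now a))
DMap-now f a _ = just refl

DMap-step-now : (f : A → B) (a : A) → Bisim _≡_ (step (now (f a))) (DMap f (step (now a)))
DMap-step-now f a zero    = nothing
DMap-step-now f a (suc _) = just refl

μD-stage₁ : (d : D (D A)) {e : D A} → proj₁ d 0 ≡ nothing → proj₁ d 1 ≡ just e →
  proj₁ (μD d) 1 ≡ proj₁ e 0
μD-stage₁ d d↑ d↓ rewrite d↑ | d↓ = refl

choose : B → B → Bool → B
choose b₁ b₂ b = if b then b₁ else b₂

module _ (ζ : {A : Set} → Pf (D A) → D (Pf A)) (law : IsDistributiveLaw ζ) where
  open IsDistributiveLaw law

  natural-≈ : (f : A → B) {xs : Pf (D A)} {ys : Pf (D B)} →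
    ys ≈PD PfMap (DMap f) xs → ζ ys ≈DP DMap (PfMap f) (ζ xs)
  natural-≈ f {xs} ys≈fxs n =
    MaybeRel-trans (SameSet-trans {R = _≡_} trans) (respects ys≈fxs n) (natural f xs n)

  v : D (Pf Bool)
  v = ζ (now true ∷ step (now false) ∷ [])

  ζ-now-step : (b₁ b₂ : B) → ζ (now b₁ ∷ step (now b₂) ∷ []) ≈DP DMap (PfMap (choose b₁ b₂)) v
  ζ-now-step b₁ b₂ = natural-≈ (choose b₁ b₂)
    (Pointwise⇒SameSet (DMap-now (choose b₁ b₂) true ∷ DMap-step-now (choose b₁ b₂) false ∷ []))

  v-stages : proj₁ v 0 ≡ nothing × false ∈ᴹ proj₁ v 1
  v-stages = v↑₀ , false∈v₁
    where
    z : D (Pf Bool)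
    z = ζ [ step (now false) ]

    z≈ : z ≈DP DMap ηP (step (now false))
    z≈ = unitP (step (now false))

    z↑₀ : proj₁ z 0 ≡ nothing
    z↑₀ = MaybeRel-nothingʳ (z≈ 0) refl

    z₁ : ∃[ T ] proj₁ z 1 ≡ just T × SameSet _≡_ T [ false ]
    z₁ = MaybeRel-justʳ (z≈ 1) refl

    T : Pf Bool
    T = proj₁ z₁

    z↓₁ : proj₁ z 1 ≡ just T
    z↓₁ = proj₁ (proj₂ z₁)

    false∈z₁ : false ∈ᴹ proj₁ z 1
    false∈z₁ = ∈ᴹ-resp⁻ (z≈ 1) ([ false ] , refl , here refl)

    ζ[]↓₀ : proj₁ (ζ {Bool} []) 0 ≡ just []
    ζ[]↓₀ with MaybeRel-justʳ (unitD {Bool} [] 0) refl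
    ... | E , ζ[]↓E , E≈[] rewrite SameSet-[] E≈[] = ζ[]↓E

    Z : D (Pf (Pf Bool))
    Z = ζ (ζ [] ∷ z ∷ [])

    Z≈ : Z ≈DP ζ (now [] ∷ step (now T) ∷ [])
    Z≈ = respects (Pointwise⇒SameSet (≈now (ζ []) ζ[]↓₀ ∷ ≈step-now z z↑₀ z↓₁ ∷ []))

    z≈⋃Z : z ≈DP DMap μP Z
    z≈⋃Z = multP ([] ∷ [ step (now false) ] ∷ [])

    v↑₀ : proj₁ v 0 ≡ nothing
    v↑₀ = mapM-nothing⁻ (PfMap (choose [] T))
      (MaybeRel-nothingˡ (ζ-now-step [] T 0)
      (MaybeRel-nothingˡ (Z≈ 0)
      (mapM-nothing⁻ μP (MaybeRel-nothingˡ (z≈⋃Z 0) z↑₀))))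

    false∈v₁ : false ∈ᴹ proj₁ v 1
    false∈v₁ with ∈ᴹ-concat⁻ (∈ᴹ-resp (z≈⋃Z 1) false∈z₁)
    ... | Q , Q∈Z₁ , false∈Q with ∈ᴹ-map⁻ (choose [] T) (∈ᴹ-resp (ζ-now-step [] T 1) (∈ᴹ-resp (Z≈ 1) Q∈Z₁))
    ... | false , false∈v₁ , _    = false∈v₁
    ... | true  , _       , refl = ⊥-elim (¬Any[] false∈Q)

  w : D (Pf Bool)
  w = ζ (step (now true) ∷ step (now false) ∷ [])

  w₁-closed-under-not : {b : Bool} → b ∈ᴹ proj₁ w 1 → not b ∈ᴹ proj₁ w 1
  w₁-closed-under-not b∈w₁ = ∈ᴹ-resp⁻ (w≈not-w 1) (∈ᴹ-map⁺ not b∈w₁)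
    where
    w≈not-w : w ≈DP DMap (PfMap not) w
    w≈not-w = natural-≈ not (SameSet-swap (DMap-step-now not false) (DMap-step-now not true))

  true∈w₁ : true ∈ᴹ proj₁ w 1
  true∈w₁ = true-or-not
    (∈ᴹ-map⁻ always-true (∈ᴹ-resp (ζ[st]≈ 1) (∈ᴹ-resp⁻ (unitP (step (now true)) 1) ([ true ] , refl , here refl))))
    where
    always-true : Bool → Bool
    always-true _ = true

    ζ[st]≈ : ζ [ step (now true) ] ≈DP DMap (PfMap always-true) w
    ζ[st]≈ = natural-≈ always-true
      ((here (DMap-step-now always-true true) ∷ []) ,
       (here (DMap-step-now always-true true) ∷ here (DMap-step-now always-true false) ∷ []))

    true-or-not : ∃[ b ] b ∈ᴹ proj₁ w 1 × true ≡ always-true b → true ∈ᴹ proj₁ w 1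
    true-or-not (true  , true∈w₁  , _) = true∈w₁
    true-or-not (false , false∈w₁ , _) = w₁-closed-under-not false∈w₁

  inner : Bool → D Bool
  inner = choose (step (now true)) (now false)

  true∉ζ-inner-image₀ : proj₁ v 0 ≡ nothing → (S : Pf Bool) → false ∈ S →
    {T : Pf (D Bool)} → SameSet _≡_ T (PfMap inner S) → ¬ true ∈ᴹ proj₁ (ζ T) 0
  true∉ζ-inner-image₀ v↑₀ S false∈S {T} T≈innerS with Bool-set-with-false S false∈S
  ... | inj₁ S≈[false,true] = ∉ᴹ-nothing ζT↑₀
    where
    T≈ : T ≈PD (now false ∷ step (now true) ∷ [])
    T≈ = ≡⇒≈PD (SameSet-trans {R = _≡_} trans T≈innerS (SameSet-map inner S≈[false,true]))

    ζT↑₀ : proj₁ (ζ T) 0 ≡ nothing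
    ζT↑₀ = MaybeRel-nothingʳ (respects T≈ 0)
      (MaybeRel-nothingʳ (ζ-now-step false true 0) (mapM-nothing (PfMap (choose false true)) v↑₀))
  ... | inj₂ S≈[false] = λ true∈ζT₀ → true∉[false] (∈ᴹ-resp (unitP (now false) 0) (∈ᴹ-resp (respects T≈ 0) true∈ζT₀))
    where
    T≈ : T ≈PD [ now false ]
    T≈ = ≡⇒≈PD (SameSet-trans {R = _≡_} trans T≈innerS (SameSet-map inner S≈[false]))

    true∉[false] : ¬ true ∈ᴹ just [ false ]
    true∉[false] (_ , refl , here ())

  nested : Pf (D (D Bool))
  nested = now (step (now true)) ∷ step (now (now false)) ∷ []

  ζ-nested≈ : ζ nested ≈DP DMap (PfMap inner) v
  ζ-nested≈ = ζ-now-step (step (now true)) (now false)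

  ⋃nested≈ : PfMap μD nested ≈PD (step (now true) ∷ step (now false) ∷ [])
  ⋃nested≈ = Pointwise⇒SameSet
    (≈step-now (μD (now (step (now true)))) refl refl ∷ ≈step-now (μD (step (now (now false)))) refl refl ∷ [])

  no-distributive-law : ⊥
  no-distributive-law with v-stages
  ... | v↑₀ , S , v↓₁ , false∈S with MaybeRel-justʳ (ζ-nested≈ 1) (mapM-just (PfMap inner) v↓₁)
  ... | T , ζ-nested↓T , T≈innerS = true∉ζ-inner-image₀ v↑₀ S false∈S T≈innerS true∈ζT₀
    where
    ζ-nested↑₀ : proj₁ (ζ nested) 0 ≡ nothing
    ζ-nested↑₀ = MaybeRel-nothingʳ (ζ-nested≈ 0) (mapM-nothing (PfMap inner) v↑₀)

    true∈ζT₀ : true ∈ᴹ proj₁ (ζ T) 0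
    true∈ζT₀ = subst (true ∈ᴹ_) (μD-stage₁ (DMap ζ (ζ nested)) (mapM-nothing ζ ζ-nested↑₀) (mapM-just ζ ζ-nested↓T))
      (∈ᴹ-resp (multD nested 1) (∈ᴹ-resp⁻ (respects ⋃nested≈ 1) true∈w₁))

proposition6p3 : ¬ Σ ({A : Set} → Pf (D A) → D (Pf A)) IsDistributiveLaw
proposition6p3 (ζ , law) = no-distributive-law ζ law
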